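{- Let $G$ be an infinite group. Then (i) $Sc_G^{\wedge}=\operatorname{cl}\{\epsilon p: \epsilon\in G^*,\ \epsilon\epsilon=\epsilon,\ p\in\beta G\}$; (ii) $Sc_G^{\wedge}$ is an ideal of the semigroup $\beta G$, and $p\in Sc_G^{\wedge}$ if and only if every member of $p$ contains a piecewise shifted $FP$-set; (iii) $Sc_G^{\wedge}$ is the smallest closed ideal of $\beta G$ containing all idempotents of $G^*$.
   Context: $\beta G$ is the compact right topological semigroup of ultrafilters on discrete $G$ ($gp=\{gP:P\in p\}$; $pq$ generated by $\bigcup_{x\in P}xQ_x$, $P\in p$, $Q_x\in q$), $G^*$ the free ultrafilters, $X^*=\{p\in G^*:X\in p\}$. For $p\in G^*$, $\Delta_p(X)=\{gp:g\in G, X\in gp\}$. $A\subseteq G$ is scattered if for every infinite $X\subseteq A$ there is $p\in X^*$ with $\Delta_p(X)$ finite; $Sc_G$ is the ideal of scattered subsets, and $Sc_G^{\wedge}=\{p\in\beta G: G\setminus A\in p$ for each $A\in Sc_G\}$. Given an injective sequence $(g_n)$ and a sequence $(b_n)$ in $G$, the set $\{g_{i_1}\cdots g_{i_k}b_{i_k}: k\ge1, 0\le i_1<\dots<i_k<\omega\}$ is a piecewise shifted $FP$-set. -}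

module Defs where

open import Level using (0ℓ; _⊔_) renaming (suc to lsuc)
open import Algebra.Bundles using (Group)
import Algebra.Properties.Group as GroupProperties
open import Data.Bool.Base using (Bool; true; false; not; _∧_; T)
open import Data.Empty using (⊥-elim)
open import Data.List.Base using (List; []; _∷_)
import Data.List.Membership.Setoid as ListMembership
open import Data.List.Relation.Unary.Linked using (Linked)
open import Data.Nat.Base using (ℕ; _<_)
open import Data.Product.Base using (Σ-syntax; ∃; ∃-syntax; _×_; _,_)
open import Data.Sum.Base using (_⊎_; inj₁; inj₂)
open import Function.Base using (id; _∘_)
open import Function.Bundles using (_⇔_)
open import Function.Definitions using (Injective)
open import Function.Properties.Equivalence using (⇔-isEquivalence)
open import Relation.Binary.Bundles using (Setoid; Poset)
open import Relation.Binary.Structures using (IsEquivalence)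
open import Relation.Binary.PropositionalEquality as ≡ using (_≡_; refl)
open import Relation.Nullary.Negation using (¬_)
open import Relation.Unary using (Pred; _∈_; _∉_; _⊆_; _≐_)

module _ {s t} (S : Setoid s t) where
  open Setoid S using (Carrier)
  open ListMembership S using () renaming (_∈_ to _∈ₗ_)

  Finite : ∀ {r} → Pred Carrier r → Set (s ⊔ t ⊔ r)
  Finite X = ∃[ xs ] (∀ {x} → x ∈ X → x ∈ₗ xs)

  Infinite : ∀ {r} → Pred Carrier r → Set (s ⊔ t ⊔ r)
  Infinite X = ¬ Finite X

-- Ultrafilter theory lives in classical set theory.  Zorn's lemma, together
-- with excluded middle, supplies that foundation; both are true in the
-- standard set-theoretic model, where Zorn's lemma is the axiom of choice.

ZornsLemma : ∀ c ℓ₁ ℓ₂ → Set (lsuc (c ⊔ ℓ₁ ⊔ ℓ₂))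
ZornsLemma c ℓ₁ ℓ₂ = (P : Poset c ℓ₁ ℓ₂) → let open Poset P in
  ((C : Pred Carrier (c ⊔ ℓ₁ ⊔ ℓ₂)) →
     (∀ {x y} → x ∈ C → y ∈ C → x ≤ y ⊎ y ≤ x) →
     ∃[ u ] (∀ {x} → x ∈ C → x ≤ u)) →
  ∃[ m ] (∀ x → m ≤ x → x ≈ m)

module Ultrafilters {c ℓ} (G : Group c ℓ) where
  open Group G renaming (refl to ≈-refl; sym to ≈-sym; trans to ≈-trans)
  open GroupProperties G using (\\-leftDividesˡ; \\-leftDividesʳ)

  -- Subsets of the group are characteristic functions.  Under excluded
  -- middle every ≈-invariant predicate, at any level, has one; this keeps the
  -- power set in the universe of the group.  Invariance under ≈ is essential:
  -- without it, ultrafilters would see the representatives of ≈-classes.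

  record Subset : Set (c ⊔ ℓ) where
    field
      χ      : Carrier → Bool
      χ-cong : ∀ {x y} → x ≈ y → χ x ≡ χ y

  open Subset public

  El : Subset → Pred Carrier 0ℓ
  El A x = T (χ A x)

  ∅ₛ : Subset
  ∅ₛ = record { χ = λ _ → false ; χ-cong = λ _ → refl }

  Gₛ : Subset
  Gₛ = record { χ = λ _ → true ; χ-cong = λ _ → refl }

  ∁ₛ : Subset → Subset
  ∁ₛ A = record { χ = not ∘ χ A ; χ-cong = ≡.cong not ∘ χ-cong A }

  _∩ₛ_ : Subset → Subset → Subset
  A ∩ₛ B = record
    { χ      = λ x → χ A x ∧ χ B x
    ; χ-cong = λ eq → ≡.cong₂ _∧_ (χ-cong A eq) (χ-cong B eq)
    }

  infix 30 _◃_

  _◃_ : Carrier → Subset → Pred Carrier (c ⊔ ℓ)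
  (g ◃ P) y = ∃[ x ] (x ∈ El P × y ≈ g ∙ x)

  record Ultrafilter : Set (lsuc (c ⊔ ℓ)) where
    field
      members : Pred Subset (c ⊔ ℓ)
      full    : Gₛ ∈ members
      proper  : ∅ₛ ∉ members
      upward  : ∀ {A B} → El A ⊆ El B → A ∈ members → B ∈ members
      meet    : ∀ {A B} → A ∈ members → B ∈ members → A ∩ₛ B ∈ members
      ultra   : ∀ A → A ∈ members ⊎ ∁ₛ A ∈ members

  open Ultrafilter public

  βG : Setoid (lsuc (c ⊔ ℓ)) (c ⊔ ℓ)
  βG = record
    { Carrier       = Ultrafilter
    ; _≈_           = λ p q → ∀ A → A ∈ members p ⇔ A ∈ members q
    ; isEquivalence = record
      { refl  = λ _ → ⇔-id
      ; sym   = λ p≈q A → ⇔-sym (p≈q A)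
      ; trans = λ p≈q q≈r A → ⇔-trans (p≈q A) (q≈r A)
      }
    }
    where open IsEquivalence ⇔-isEquivalence renaming (refl to ⇔-id; sym to ⇔-sym; trans to ⇔-trans)

  open Setoid βG public using () renaming (_≈_ to _≈β_)

  SubsetOfβG : Set (lsuc (lsuc (c ⊔ ℓ)))
  SubsetOfβG = Pred Ultrafilter (lsuc (c ⊔ ℓ))

  T-∧-intro : ∀ a {b} → T a → T b → T (a ∧ b)
  T-∧-intro true _ tb = tb

  T-∧-fst : ∀ a {b} → T (a ∧ b) → T a
  T-∧-fst true _ = _

  T-∧-snd : ∀ a {b} → T (a ∧ b) → T b
  T-∧-snd true tb = tb

  T-not : ∀ b → T b → T (not b) → ∀ {z} {Z : Set z} → Z
  T-not true _ ()

  resp : ∀ (A : Subset) {x y} → x ≈ y → x ∈ El A → y ∈ El A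
  resp A x≈y = ≡.subst T (χ-cong A x≈y)

  disjoint : ∀ p {A} → A ∈ members p → ∁ₛ A ∉ members p
  disjoint p {A} a a′ = proper p
    (upward p (λ {x} t → T-not (χ A x) (T-∧-fst (χ A x) t) (T-∧-snd (χ A x) t)) (meet p a a′))

  preimage : Carrier → Subset → Subset
  preimage g A = record { χ = λ x → χ A (g ∙ x) ; χ-cong = χ-cong A ∘ ∙-congˡ }

  translate≐ : ∀ g A → El A ≐ g ◃ preimage g A
  translate≐ g A =
    (λ {y} y∈A → g \\ y , resp A (≈-sym (\\-leftDividesˡ g y)) y∈A , ≈-sym (\\-leftDividesˡ g y)) ,
    (λ (x , gx∈A , y≈gx) → resp A (≈-sym y≈gx) gx∈A)

  infixr 30 _◂_ _⊙_

  _◂_ : Carrier → Ultrafilter → Ultrafilter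
  members (g ◂ p) A = ∃[ P ] (P ∈ members p × El A ≐ g ◃ P)
  full    (g ◂ p) = preimage g Gₛ , full p , translate≐ g Gₛ
  proper  (g ◂ p) (P , P∈p , _ , ⊇) =
    proper p (upward p (λ {x} x∈P → ⊇ (x , x∈P , ≈-refl)) P∈p)
  upward  (g ◂ p) {A} {B} A⊆B (P , P∈p , _ , ⊇) =
    preimage g B , upward p (λ {x} x∈P → A⊆B (⊇ (x , x∈P , ≈-refl))) P∈p , translate≐ g B
  meet    (g ◂ p) {A} {B} (P , P∈p , _ , ⊇₁) (Q , Q∈p , _ , ⊇₂) =
    preimage g (A ∩ₛ B) ,
    upward p (λ {x} t → T-∧-intro (χ A (g ∙ x))
                          (⊇₁ (x , T-∧-fst (χ P x) t , ≈-refl))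
                          (⊇₂ (x , T-∧-snd (χ P x) t , ≈-refl)))
             (meet p P∈p Q∈p) ,
    translate≐ g (A ∩ₛ B)
  ultra   (g ◂ p) A with ultra p (preimage g A)
  ... | inj₁ m = inj₁ (preimage g A , m , translate≐ g A)
  ... | inj₂ m = inj₂ (preimage g (∁ₛ A) , m , translate≐ g (∁ₛ A))

  holds : ∀ q A → Bool
  holds q A with ultra q A
  ... | inj₁ _ = true
  ... | inj₂ _ = false

  holds-sound : ∀ q A → T (holds q A) → A ∈ members q
  holds-sound q A t with ultra q A
  ... | inj₁ m = m

  holds-complement : ∀ q A → T (not (holds q A)) → ∁ₛ A ∈ members q
  holds-complement q A t with ultra q A
  ... | inj₂ m = m

  holds-cong : ∀ q A B → El A ⊆ El B → El B ⊆ El A → holds q A ≡ holds q B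
  holds-cong q A B A⊆B B⊆A with ultra q A | ultra q B
  ... | inj₁ _ | inj₁ _ = refl
  ... | inj₁ m | inj₂ n = ⊥-elim (disjoint q {B} (upward q A⊆B m) n)
  ... | inj₂ m | inj₁ n = ⊥-elim (disjoint q {A} (upward q B⊆A n) m)
  ... | inj₂ _ | inj₂ _ = refl

  fibre : Ultrafilter → Subset → Subset
  fibre q A = record
    { χ      = λ x → holds q (preimage x A)
    ; χ-cong = λ {x} {y} x≈y → holds-cong q (preimage x A) (preimage y A)
                 (resp A (∙-congʳ x≈y)) (resp A (∙-congʳ (≈-sym x≈y)))
    }

  _⊙_ : Ultrafilter → Ultrafilter → Ultrafilter
  members (p ⊙ q) A = ∃[ P ] (P ∈ members p ×
    Σ[ Q ∈ (Carrier → Subset) ]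
      ((∀ {x} → x ∈ El P → Q x ∈ members q) ×
       (∀ {x y} → x ∈ El P → y ∈ El (Q x) → x ∙ y ∈ El A)))
  full    (p ⊙ q) = Gₛ , full p , (λ _ → Gₛ) , (λ _ → full q) , _
  proper  (p ⊙ q) (P , P∈p , Q , Q∈q , ⊆∅) =
    proper p (upward p (λ {x} x∈P → ⊥-elim (proper q (upward q (λ {y} → ⊆∅ {x} {y} x∈P) (Q∈q x∈P)))) P∈p)
  upward  (p ⊙ q) A⊆B (P , P∈p , Q , Q∈q , ⊆A) =
    P , P∈p , Q , Q∈q , λ x∈P y∈Q → A⊆B (⊆A x∈P y∈Q)
  meet    (p ⊙ q) {A} {B} (P , P∈p , Q , Q∈q , ⊆A) (P′ , P′∈p , Q′ , Q′∈q , ⊆B) =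
    P ∩ₛ P′ , meet p P∈p P′∈p , (λ x → Q x ∩ₛ Q′ x) ,
    (λ {x} t → meet q (Q∈q (T-∧-fst (χ P x) t)) (Q′∈q (T-∧-snd (χ P x) t))) ,
    (λ {x} {y} t u → T-∧-intro (χ A (x ∙ y))
                       (⊆A (T-∧-fst (χ P x) t) (T-∧-fst (χ (Q x) y) u))
                       (⊆B (T-∧-snd (χ P x) t) (T-∧-snd (χ (Q x) y) u)))
  ultra   (p ⊙ q) A with ultra p (fibre q A)
  ... | inj₁ m = inj₁ (fibre q A , m , (λ x → preimage x A) ,
                       (λ {x} → holds-sound q (preimage x A)) , λ _ → id)
  ... | inj₂ m = inj₂ (∁ₛ (fibre q A) , m , (λ x → preimage x (∁ₛ A)) ,
                       (λ {x} → holds-complement q (preimage x A)) , λ _ → id)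

  Free : Pred Ultrafilter (c ⊔ ℓ)
  Free p = ∀ x → ∃[ A ] (A ∈ members p × x ∉ El A)

  _* : Subset → Pred Ultrafilter (c ⊔ ℓ)
  (X *) p = p ∈ Free × X ∈ members p

  Idempotent : Pred Ultrafilter (c ⊔ ℓ)
  Idempotent e = e ⊙ e ≈β e

  Δ : Ultrafilter → Subset → Pred Ultrafilter (c ⊔ ℓ)
  Δ p X q = ∃[ g ] (X ∈ members (g ◂ p) × q ≈β g ◂ p)

  Scattered : Pred Subset (lsuc (c ⊔ ℓ))
  Scattered A = ∀ X → El X ⊆ El A → Infinite setoid (El X) →
    ∃[ p ] (p ∈ X * × Finite βG (Δ p X))

  Sc^ : SubsetOfβG
  Sc^ p = ∀ A → A ∈ Scattered → ∁ₛ A ∈ members p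

  -- The sets { p | A ∈ p }, A ⊆ G, form a base of the topology of βG.
  cl : SubsetOfβG → SubsetOfβG
  cl S p = ∀ A → A ∈ members p → ∃[ q ] (q ∈ S × A ∈ members q)

  Closed : Pred SubsetOfβG (lsuc (c ⊔ ℓ))
  Closed S = cl S ⊆ S

  -- Ideals are two-sided and nonempty.
  IsIdeal : Pred SubsetOfβG (lsuc (c ⊔ ℓ))
  IsIdeal I = ∃ I × (∀ p q → p ∈ I → p ⊙ q ∈ I × q ⊙ p ∈ I)

  ContainsFreeIdempotents : Pred SubsetOfβG (lsuc (c ⊔ ℓ))
  ContainsFreeIdempotents S = ∀ e → e ∈ Free → e ∈ Idempotent → e ∈ S

  FreeIdempotentMultiples : SubsetOfβG
  FreeIdempotentMultiples r = ∃[ e ] ∃[ p ] (e ∈ Free × e ∈ Idempotent × r ≈β e ⊙ p)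

  -- The indices i₁, …, iₖ are passed as a head and a tail, so that k ≥ 1.
  shiftedProduct : (g b : ℕ → Carrier) → ℕ → List ℕ → Carrier
  shiftedProduct g b i []       = g i ∙ b i
  shiftedProduct g b i (j ∷ js) = g i ∙ shiftedProduct g b j js

  PiecewiseShiftedFP : (g b : ℕ → Carrier) → Pred Carrier ℓ
  PiecewiseShiftedFP g b x =
    ∃[ i ] ∃[ is ] (Linked _<_ (i ∷ is) × x ≈ shiftedProduct g b i is)

  ContainsPiecewiseShiftedFP : Pred Subset (c ⊔ ℓ)
  ContainsPiecewiseShiftedFP A =
    ∃[ g ] ∃[ b ] (Injective _≡_ _≈_ g × PiecewiseShiftedFP g b ⊆ El A)

{-# OPTIONS --safe #-}
module Submission where

-- For A ⊆ G the following are equivalent: A is not scattered; A ∈ εp for some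
-- idempotent ε ∈ G* and some p; A contains a piecewise shifted FP-set.
--
-- If X ⊆ A is infinite and every Δ_p(X), p ∈ X*, is infinite, then a closed
-- subset of X* which is minimal among those containing qp whenever they
-- contain p, q ∈ G* and X ∈ qp, contains some r = qr with q ∈ G*, and by
-- Ellis–Numakura q may be taken idempotent.  If A ∈ r = εr, then setting
-- A₀ = A and Aₙ₊₁ = Aₙ ∩ gₙ⁻¹Aₙ ∈ r, with gₙ fresh, yields an FP-set in A.
-- Finally, for the tails Yₘ of an FP-set and p ∈ Y₀*, descending along Yₘ
-- exhibits every gₘ as a quotient of two elements of { g | Y₀ ∈ gp }, which is
-- therefore infinite; as G acts freely on βG, so is Δ_p(Y₀).
--
-- So Sc^ is the closure of { εp }, and it consists of the p whose members
-- contain FP-sets; the first description gives the right ideal property and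
-- minimality, the second one the left ideal property, by conjugating FP-sets.

open import Defs
open import Algebra.Bundles using (Group)
import Algebra.Properties.Group as GroupProperties
open import Axiom.ExcludedMiddle using (ExcludedMiddle)
open import Data.Bool.Base using (true; false)
open import Data.Empty using (⊥-elim)
open import Data.Fin.Base using (toℕ)
open import Data.Fin.Properties using (pigeonhole)
open import Data.List.Base using ([]; _∷_; _++_; map; cartesianProductWith)
import Data.List.Membership.Setoid as ListMembership
import Data.List.Membership.Setoid.Properties as ListMembershipₚ
open import Data.List.Relation.Unary.Any using (here; there; index)
open import Data.List.Relation.Unary.Linked using (Linked; [-]; _∷_)
open import Data.Nat.Base as ℕ using (ℕ; zero; suc; _≤_; _<_; _≤′_; ≤′-refl; ≤′-step)
open import Data.Nat.Properties using (≤-refl; ≤⇒≤′; m≤n⇒m<n∨m≡n; <-cmp; <⇒≢)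
open import Data.Product.Base using (Σ-syntax; ∃; ∃-syntax; _×_; _,_; proj₁; proj₂)
open import Data.Sum.Base using (_⊎_; inj₁; inj₂; [_,_]′)
open import Function.Base using (id; _∘_; case_of_)
open import Function.Bundles using (_⇔_; mk⇔; Equivalence)
open import Function.Definitions using (Injective)
open import Level using (Level; Lift; lift; lower; _⊔_) renaming (suc to lsuc)
open import Relation.Binary.Bundles using (Setoid; Poset)
open import Relation.Binary.Core using (Rel)
open import Relation.Binary.Definitions using (Reflexive; Transitive; tri<; tri≈; tri>; _Respects_)
open import Relation.Binary.PropositionalEquality as ≡ using (_≡_; refl)
open import Relation.Nullary.Decidable using (Dec; yes; no; True; isYes; toWitness; fromWitness; decidable-stable)
open import Relation.Nullary.Negation using (¬_; contradiction)
open import Relation.Unary using (Pred; U; _∈_; _∉_; _⊆_; _≐_)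

open Equivalence using (to; from)

-- Injective sequences and finite lists.

module _ {s t} (S : Setoid s t) where
  open Setoid S
  open ListMembership S using () renaming (_∈_ to _∈ₗ_)

  -- Among the first `length xs` + 1 terms, two would occupy the same position of `xs`.
  injective-sequence-escapes : ∀ {g : ℕ → Carrier} → Injective _≡_ _≈_ g → ∀ xs → ¬ (∀ n → g n ∈ₗ xs)
  injective-sequence-escapes {g} inj xs g∈xs =
    let i , j , i<j , eq = pigeonhole ≤-refl (λ i → index (g∈xs (toℕ i)))
    in <⇒≢ i<j (inj (ListMembershipₚ.index-injective S (g∈xs (toℕ i)) (g∈xs (toℕ j)) eq))

-- Consequences of excluded middle and Zorn's lemma.

module Classical
  (em : ∀ {a} → ExcludedMiddle a)
  (zorn : ∀ {a b d} → ZornsLemma a b d) where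

  by-contradiction : ∀ {a} {P : Set a} → ¬ ¬ P → P
  by-contradiction = decidable-stable em

  ¬∀⇒∃¬ : ∀ {a b} {A : Set a} {P : A → Set b} → ¬ (∀ x → P x) → ∃[ x ] ¬ P x
  ¬∀⇒∃¬ ¬∀ = by-contradiction λ ¬∃ → ¬∀ λ x → by-contradiction λ ¬Px → ¬∃ (x , ¬Px)

  -- Excluded middle makes every proposition available in every universe.
  Resize : ∀ {a} b → Set a → Set b
  Resize b P = Lift b (True (em {P = P}))

  resize : ∀ {a b} {P : Set a} → P → Resize b P
  resize p = lift (fromWitness p)

  unresize : ∀ {a b} {P : Set a} → Resize b P → P
  unresize (lift t) = toWitness t

  -- Empty chains are bounded by x₀.
  maximal-above : ∀ {a b} {A : Set a} (_≼_ : Rel A b) → Reflexive _≼_ → Transitive _≼_ →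
    (∀ (C : Pred A (a ⊔ b)) → ∃ C → (∀ {x y} → x ∈ C → y ∈ C → x ≼ y ⊎ y ≼ x) →
      ∃[ u ] (∀ {x} → x ∈ C → x ≼ u)) →
    ∀ x₀ → ∃[ m ] (x₀ ≼ m × (∀ x → m ≼ x → x ≼ m))
  maximal-above {a} {b} {A} _≼_ ≼-refl ≼-trans bounded x₀ =
    let (m , x₀≼m) , max = zorn above bounded-above in
    m , x₀≼m , λ x m≼x → proj₁ (max (x , ≼-trans x₀≼m m≼x) m≼x)
    where
    above : Poset (a ⊔ b) b b
    above = record
      { Carrier = ∃[ x ] x₀ ≼ x
      -- Taking mutual comparison as equality turns the preorder into a poset, as Zorn's lemma
      -- demands.
      ; _≈_ = λ x y → proj₁ x ≼ proj₁ y × proj₁ y ≼ proj₁ x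
      ; _≤_ = λ x y → proj₁ x ≼ proj₁ y
      ; isPartialOrder = record
        { isPreorder = record
          { isEquivalence = record
            { refl = ≼-refl , ≼-refl
            ; sym = λ (p , q) → q , p
            ; trans = λ (p , q) (p′ , q′) → ≼-trans p p′ , ≼-trans q′ q
            }
          ; reflexive = proj₁
          ; trans = ≼-trans
          }
        ; antisym = _,_
        }
      }
    bounded-above : (C : Pred (∃[ x ] x₀ ≼ x) (a ⊔ b)) →
      (∀ {x y} → x ∈ C → y ∈ C → proj₁ x ≼ proj₁ y ⊎ proj₁ y ≼ proj₁ x) →
      ∃[ u ] (∀ {x} → x ∈ C → proj₁ x ≼ proj₁ u)
    bounded-above C chain with em {P = ∃ C}
    ... | no ∄ = (x₀ , ≼-refl) , λ x∈C → contradiction (_ , x∈C) ∄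
    ... | yes ((x , x₀≼x) , x∈C) =
      let u , ub = bounded (λ y → Σ[ h ∈ x₀ ≼ y ] C (y , h)) (x , x₀≼x , x∈C)
                     (λ (_ , c) (_ , d) → chain c d)
      in (u , ≼-trans x₀≼x (ub (x₀≼x , x∈C))) , λ {y} y∈C → ub (proj₂ y , y∈C)

  module _ {s t s′ t′} (S : Setoid s t) (S′ : Setoid s′ t′) where
    open Setoid S using () renaming (Carrier to A; _≈_ to _≈₁_)
    open Setoid S′ using (trans; sym) renaming (Carrier to B; _≈_ to _≈₂_)

    -- Injectivity leaves at most one preimage per listed value, and excluded middle decides whether
    -- there is one to list.
    finite-preimage : ∀ {r} {f : A → B} {Y : Pred B r} → Injective _≈₁_ _≈₂_ f →
      Finite S′ Y → Finite S (Y ∘ f)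
    finite-preimage {f = f} inj (ys , ⊆ys) = let xs , ⊆xs = preimages ys in xs , λ fx∈Y → ⊆xs (⊆ys fx∈Y)
      where
      open ListMembership S using () renaming (_∈_ to _∈₁_)
      open ListMembership S′ using () renaming (_∈_ to _∈₂_)
      preimages : ∀ ys → ∃[ xs ] (∀ {x} → f x ∈₂ ys → x ∈₁ xs)
      preimages [] = [] , λ ()
      preimages (y ∷ ys) with preimages ys | em {P = ∃[ x ] f x ≈₂ y}
      ... | xs , ⊆xs | yes (x , fx≈y) = x ∷ xs , λ where
        (here fz≈y) → here (inj (trans fz≈y (sym fx≈y)))
        (there fz∈ys) → there (⊆xs fz∈ys)
      ... | xs , ⊆xs | no ∄ = xs , λ where
        (here fz≈y) → contradiction (_ , fz≈y) ∄
        (there fz∈ys) → ⊆xs fz∈ys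

  module UltrafilterTheory {c ℓ} (G : Group c ℓ) where
    open Group G renaming (refl to ≈-refl; sym to ≈-sym; trans to ≈-trans)
    open GroupProperties G
    open Ultrafilters G
    open ListMembership setoid using () renaming (_∈_ to _∈ₗ_)

    private
      v : Level
      v = c ⊔ ℓ

    -- Boolean operations on subsets and basic properties of ultrafilters.

    ∁-intro : ∀ A {x} → x ∉ El A → x ∈ El (∁ₛ A)
    ∁-intro A {x} x∉A with χ A x
    ... | true = x∉A _
    ... | false = _

    ∁-elim : ∀ A {x} → x ∈ El (∁ₛ A) → x ∉ El A
    ∁-elim A {x} x∈∁A x∈A = T-not (χ A x) x∈A x∈∁A

    ∩-intro : ∀ A B {x} → x ∈ El A → x ∈ El B → x ∈ El (A ∩ₛ B)
    ∩-intro A B {x} = T-∧-intro (χ A x)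

    ∩-elimˡ : ∀ A B → El (A ∩ₛ B) ⊆ El A
    ∩-elimˡ A B {x} = T-∧-fst (χ A x)

    ∩-elimʳ : ∀ A B → El (A ∩ₛ B) ⊆ El B
    ∩-elimʳ A B {x} = T-∧-snd (χ A x)

    -- Excluded middle computes the characteristic function, so a predicate of any level enters the
    -- one universe of `Subset`; `toWitness` and `fromWitness` translate back and forth.
    subset : ∀ {r} (P : Pred Carrier r) → P Respects _≈_ → Subset
    subset P P-resp = record
      { χ = λ x → isYes (em {P = P x})
      ; χ-cong = λ x≈y → isYes-cong (P-resp x≈y) (P-resp (≈-sym x≈y))
      }
      where
      isYes-cong : ∀ {r} {A B : Set r} {a? : Dec A} {b? : Dec B} →
        (A → B) → (B → A) → isYes a? ≡ isYes b?
      isYes-cong {a? = yes _} {yes _} f g = refl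
      isYes-cong {a? = yes a} {no ¬b} f g = contradiction (f a) ¬b
      isYes-cong {a? = no ¬a} {yes b} f g = contradiction (g b) ¬a
      isYes-cong {a? = no _} {no _} f g = refl

    ∁｛_｝ : Carrier → Subset
    ∁｛ x ｝ = subset (λ y → ¬ (y ≈ x)) (λ y≈z y≉x z≈x → y≉x (≈-trans y≈z z≈x))

    nonempty : ∀ p {A} → A ∈ members p → ∃ (El A)
    nonempty p {A} A∈p = by-contradiction λ ∄ → proper p (upward p (λ {x} x∈A → ⊥-elim (∄ (x , x∈A))) A∈p)

    ∉⇒∁∈ : ∀ p {A} → A ∉ members p → ∁ₛ A ∈ members p
    ∉⇒∁∈ p {A} A∉p = [ (λ A∈p → contradiction A∈p A∉p) , id ]′ (ultra p A)

    -- Ultrafilters are prime: if `A` is not in `p`, then `C` minus `A`, which lies inside `B`, is.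
    ∪∈⇒∈⊎∈ : ∀ p A B {C} → C ∈ members p → (∀ {x} → x ∈ El C → x ∈ El A ⊎ x ∈ El B) →
      A ∈ members p ⊎ B ∈ members p
    ∪∈⇒∈⊎∈ p A B {C} C∈p ⊆∪ with ultra p A
    ... | inj₁ A∈p = inj₁ A∈p
    ... | inj₂ ∁A∈p = inj₂ (upward p
      (λ t → [ (λ x∈A → contradiction x∈A (∁-elim A (∩-elimʳ C (∁ₛ A) t))) , id ]′ (⊆∪ (∩-elimˡ C (∁ₛ A) t)))
      (meet p C∈p ∁A∈p))

    -- Ultrafilters are maximal filters: a set missing from `p` has its complement in `p`, hence in
    -- `q`. Equalities in βG thus need only one inclusion.
    members-⊆⇒≈β : ∀ p q → members p ⊆ members q → p ≈β q
    members-⊆⇒≈β p q p⊆q A = mk⇔ p⊆q λ A∈q → by-contradiction λ A∉p →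
      disjoint q A∈q (p⊆q (∉⇒∁∈ p A∉p))

    -- Compactness of βG

    record IsProperFilter (F : Pred Subset v) : Set v where
      field
        full    : Gₛ ∈ F
        proper  : ∅ₛ ∉ F
        upward  : ∀ {A B} → El A ⊆ El B → A ∈ F → B ∈ F
        meet    : ∀ {A B} → A ∈ F → B ∈ F → A ∩ₛ B ∈ F

    module _ {F : Pred Subset v} (F-filter : IsProperFilter F) where
      private
        module F = IsProperFilter F-filter

      -- The filter generated by `F` and `A`.
      adjoin : Subset → Pred Subset v
      adjoin A B = ∃[ M ] (M ∈ F × El (M ∩ₛ A) ⊆ El B)

      adjoin-filter : ∀ A → ∁ₛ A ∉ F → IsProperFilter (adjoin A)
      adjoin-filter A ∁A∉F = record
        { full = Gₛ , F.full , _
        ; proper = λ (M , M∈F , ⊆∅) → ∁A∉F (F.upward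
            (λ x∈M → ∁-intro A λ x∈A → ⊆∅ (∩-intro M A x∈M x∈A)) M∈F)
        ; upward = λ B⊆C (M , M∈F , ⊆B) → M , M∈F , λ t → B⊆C (⊆B t)
        ; meet = λ {B} {C} (M , M∈F , ⊆B) (N , N∈F , ⊆C) → M ∩ₛ N , F.meet M∈F N∈F , λ t →
            let MN = ∩-elimˡ (M ∩ₛ N) A t ; a = ∩-elimʳ (M ∩ₛ N) A t in
            ∩-intro B C (⊆B (∩-intro M A (∩-elimˡ M N MN) a)) (⊆C (∩-intro N A (∩-elimʳ M N MN) a))
        }

    ultrafilter-lemma : ∀ {F} → IsProperFilter F → ∃[ p ] F ⊆ members p
    ultrafilter-lemma {F} F-filter = p , F⊆M
      where
      Filter : Set (lsuc v)
      Filter = ∃ IsProperFilter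

      maximal : ∃[ m ] (F ⊆ proj₁ m × (∀ (x : Filter) → proj₁ m ⊆ proj₁ x → proj₁ x ⊆ proj₁ m))
      maximal = maximal-above {A = Filter} (λ x y → proj₁ x ⊆ proj₁ y) id (λ f g → g ∘ f)
        union-bounds (F , F-filter)
        where
        union-bounds : (C : Pred Filter (lsuc v)) → ∃ C →
          (∀ {x y} → x ∈ C → y ∈ C → proj₁ x ⊆ proj₁ y ⊎ proj₁ y ⊆ proj₁ x) →
          Σ[ u ∈ Filter ] (∀ {x} → x ∈ C → proj₁ x ⊆ proj₁ u)
        union-bounds C ((N , N-filter) , N∈C) chain = (⋃C , ⋃C-filter) , λ x∈C A∈x → resize (_ , x∈C , A∈x)
          where
          ⋃C : Pred Subset v
          -- Quantifying over filters raises the level; `Resize` brings the union back to `v`.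
          ⋃C A = Resize v (∃[ x ] (x ∈ C × A ∈ proj₁ x))
          ⋃C-filter : IsProperFilter ⋃C
          ⋃C-filter = record
            { full = resize (_ , N∈C , IsProperFilter.full N-filter)
            ; proper = λ ∅∈⋃C → let (_ , x-filter) , _ , ∅∈x = unresize ∅∈⋃C in IsProperFilter.proper x-filter ∅∈x
            ; upward = λ A⊆B A∈⋃C → let (x , x-filter) , x∈C , A∈x = unresize A∈⋃C in
                resize ((x , x-filter) , x∈C , IsProperFilter.upward x-filter A⊆B A∈x)
            ; meet = λ A∈⋃C B∈⋃C →
                let (x , x-filter) , x∈C , A∈x = unresize A∈⋃C
                    (y , y-filter) , y∈C , B∈y = unresize B∈⋃C in
                case chain x∈C y∈C of λ where
                  (inj₁ x⊆y) → resize (_ , y∈C , IsProperFilter.meet y-filter (x⊆y A∈x) B∈y)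
                  (inj₂ y⊆x) → resize (_ , x∈C , IsProperFilter.meet x-filter A∈x (y⊆x B∈y))
            }

      M : Pred Subset v
      M = proj₁ (proj₁ maximal)
      F⊆M : F ⊆ M
      F⊆M = proj₁ (proj₂ maximal)
      M-filter : IsProperFilter M
      M-filter = proj₂ (proj₁ maximal)
      module M = IsProperFilter M-filter

      p : Ultrafilter
      p = record
        { members = M
        ; full = M.full
        ; proper = M.proper
        ; upward = M.upward
        ; meet = M.meet
        ; ultra = λ A → case em of λ where
            (yes ∁A∈M) → inj₂ ∁A∈M
            -- Adjoining `A` gives a proper filter above `M`, so by maximality `A` was already in
            -- `M`.
            (no ∁A∉M) → inj₁ (proj₂ (proj₂ maximal) (adjoin M-filter A , adjoin-filter M-filter A ∁A∉M)
              (λ {B} B∈M → B , B∈M , ∩-elimˡ B A) (Gₛ , M.full , ∩-elimʳ Gₛ A))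
        }

    -- The sets that belong to every point of some `K i` form a proper filter, by directedness and
    -- nonemptiness. An ultrafilter `p` extending it is in the closure of each `K i`: were `A` in
    -- `p` but in no point of `K i`, the complement of `A` would be in the filter.
    compactness : ∀ {i} {I : Set i} (K : I → SubsetOfβG) → I →
      (∀ i → Closed (K i)) → (∀ i → ∃ (K i)) → (∀ i j → ∃[ k ] (K k ⊆ K i × K k ⊆ K j)) →
      ∃[ p ] (∀ i → p ∈ K i)
    compactness {I = I} K i₀ K-closed K-nonempty K-directed =
      let p , F⊆p = ultrafilter-lemma F-filter in
      p , λ i → K-closed i λ A A∈p → by-contradiction λ ∄ →
        disjoint p A∈p (F⊆p (resize (i , λ {q} q∈K → ∉⇒∁∈ q λ A∈q → ∄ (q , q∈K , A∈q))))
      where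
      F : Pred Subset v
      F A = Resize v (∃[ i ] (∀ {q} → q ∈ K i → A ∈ members q))
      F-filter : IsProperFilter F
      F-filter = record
        { full = resize (i₀ , λ {q} _ → full q)
        ; proper = λ ∅∈F → let i , ∅∈ = unresize ∅∈F ; q , q∈K = K-nonempty i in proper q (∅∈ q∈K)
        ; upward = λ A⊆B A∈F → let i , A∈ = unresize A∈F in resize (i , λ {q} q∈K → upward q A⊆B (A∈ q∈K))
        ; meet = λ A∈F B∈F →
            let i , A∈ = unresize A∈F ; j , B∈ = unresize B∈F ; k , k⊆i , k⊆j = K-directed i j in
            resize (k , λ {q} q∈K → meet q (A∈ (k⊆i q∈K)) (B∈ (k⊆j q∈K)))
        }

    closed-resp : ∀ {K p q} → Closed K → p ≈β q → p ∈ K → q ∈ K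
    closed-resp K-closed p≈q p∈K = K-closed λ A A∈q → _ , p∈K , from (p≈q A) A∈q

    -- Minimal closed sets with a property stable under intersections.

    ⋂ : ∀ {i} {I : Set i} → (I → SubsetOfβG) → SubsetOfβG
    ⋂ K p = Resize (lsuc v) (∀ i → p ∈ K i)

    -- Zorn's lemma for reverse inclusion; compactness keeps the intersection of a chain nonempty.
    -- The property `Φ` will be that of being a subsemigroup, and later invariance.
    minimal-closed : ∀ {r} (Φ : Pred SubsetOfβG r) →
      (∀ {i} {I : Set i} (K : I → SubsetOfβG) → (∀ i → Φ (K i)) → Φ (⋂ K)) →
      ∀ S → Closed S → ∃ S → Φ S →
      ∃[ M ] (M ⊆ S × Closed M × ∃ M × Φ M ×
        (∀ K → Closed K → ∃ K → Φ K → K ⊆ M → M ⊆ K))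
    minimal-closed {r} Φ Φ-⋂ S S-closed S-nonempty S-Φ =
      let (M , M-closed , M-nonempty , M-Φ) , M⊆S , minimal =
            maximal-above {A = Candidate} (λ x y → proj₁ y ⊆ proj₁ x) id (λ f g → f ∘ g)
              intersection-bounds (S , S-closed , S-nonempty , S-Φ)
      in M , M⊆S , M-closed , M-nonempty , M-Φ , λ K K-closed K-nonempty K-Φ →
           minimal (K , K-closed , K-nonempty , K-Φ)
      where
      Candidate : Set (lsuc (lsuc v) ⊔ r)
      Candidate = ∃[ K ] (Closed K × ∃ K × Φ K)

      intersection-bounds : (C : Pred Candidate _) → ∃ C →
        (∀ {x y} → x ∈ C → y ∈ C → proj₁ y ⊆ proj₁ x ⊎ proj₁ x ⊆ proj₁ y) →
        Σ[ u ∈ Candidate ] (∀ {x} → x ∈ C → proj₁ u ⊆ proj₁ x)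
      intersection-bounds C i₀ chain =
        (⋂ K , (λ {p} → ⋂-closed {p}) , ⋂-nonempty , Φ-⋂ K (proj₂ ∘ proj₂ ∘ proj₂ ∘ proj₁)) ,
        λ x∈C p∈⋂ → unresize p∈⋂ (_ , x∈C)
        where
        K : ∃ C → SubsetOfβG
        K = proj₁ ∘ proj₁
        K-closed : ∀ i → Closed (K i)
        K-closed = proj₁ ∘ proj₂ ∘ proj₁
        ⋂-closed : Closed (⋂ K)
        ⋂-closed p∈cl = resize λ i → K-closed i λ A A∈p →
          let q , q∈⋂ , A∈q = p∈cl A A∈p in q , unresize q∈⋂ i , A∈q
        ⋂-nonempty : ∃ (⋂ K)
        ⋂-nonempty =
          let p , p∈K = compactness K i₀ K-closed (proj₁ ∘ proj₂ ∘ proj₂ ∘ proj₁) K-directed in p , resize p∈K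
          where
          K-directed : ∀ i j → ∃[ k ] (K k ⊆ K i × K k ⊆ K j)
          K-directed i@(_ , i∈C) j@(_ , j∈C) with chain i∈C j∈C
          ... | inj₁ j⊆i = j , j⊆i , λ p∈ → p∈
          ... | inj₂ i⊆j = i , (λ p∈ → p∈) , i⊆j

    -- Products of ultrafilters and idempotents

    fibre-elim : ∀ q A {x} → x ∈ El (fibre q A) → preimage x A ∈ members q
    fibre-elim q A {x} = holds-sound q (preimage x A)

    fibre-intro : ∀ q A {x} → preimage x A ∈ members q → x ∈ El (fibre q A)
    fibre-intro q A {x} A∈ = by-contradiction λ x∉f →
      disjoint q A∈ (holds-complement q (preimage x A) (∁-intro (fibre q A) x∉f))

    -- With its converse below, this replaces the generating sets of the product by the one
    -- condition that { x | x⁻¹A ∈ q } belongs to `p`.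
    ∈⊙⇒fibre∈ : ∀ p q A → A ∈ members (p ⊙ q) → fibre q A ∈ members p
    ∈⊙⇒fibre∈ p q A (P , P∈p , Q , Q∈q , ⊆A) =
      upward p (λ {x} x∈P → fibre-intro q A (upward q {Q x} {preimage x A} (⊆A x∈P) (Q∈q x∈P))) P∈p

    fibre∈⇒∈⊙ : ∀ p q A → fibre q A ∈ members p → A ∈ members (p ⊙ q)
    fibre∈⇒∈⊙ p q A f∈p = fibre q A , f∈p , (λ x → preimage x A) , (λ {x} → fibre-elim q A {x}) , λ _ → id

    ⊙-cong : ∀ {p p′ q q′} → p ≈β p′ → q ≈β q′ → p ⊙ q ≈β p′ ⊙ q′
    ⊙-cong {p} {p′} {q} {q′} p≈p′ q≈q′ = members-⊆⇒≈β (p ⊙ q) (p′ ⊙ q′) λ (P , P∈p , Q , Q∈q , ⊆A) →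
      P , to (p≈p′ P) P∈p , Q , (λ {x} x∈P → to (q≈q′ (Q x)) (Q∈q x∈P)) , ⊆A

    -- Either side says of `A` that xyz ∈ A for `p`-many x, `q`-many y and `r`-many z, nested in
    -- this order.
    ⊙-assoc : ∀ p q r → (p ⊙ q) ⊙ r ≈β p ⊙ (q ⊙ r)
    ⊙-assoc p q r = members-⊆⇒≈β ((p ⊙ q) ⊙ r) (p ⊙ (q ⊙ r)) λ {A} A∈pqr →
      fibre∈⇒∈⊙ p (q ⊙ r) A (upward p {fibre q (fibre r A)} {fibre (q ⊙ r) A}
        (λ {x} x∈f → fibre-intro (q ⊙ r) A (fibre∈⇒∈⊙ q r (preimage x A)
          (upward q {preimage x (fibre r A)} {fibre r (preimage x A)}
            (λ {y} y∈f → fibre-intro r (preimage x A)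
              (upward r {preimage (x ∙ y) A} {preimage y (preimage x A)}
                (λ {z} → resp A (assoc x y z))
                (fibre-elim r A y∈f)))
            (fibre-elim q (fibre r A) x∈f))))
        (∈⊙⇒fibre∈ p q (fibre r A) (∈⊙⇒fibre∈ (p ⊙ q) r A A∈pqr)))

    open Setoid βG using () renaming (refl to ≈β-refl; sym to ≈β-sym; trans to ≈β-trans)

    -- Right translates, stabilisers and the Ellis-Numakura theorem.

    _·_ : SubsetOfβG → Ultrafilter → SubsetOfβG
    (T · x) r = ∃[ y ] (y ∈ T × r ≈β y ⊙ x)

    -- Compactness: for each `A` in `r`, the y in `T` with A ∈ yx form a nonempty closed set, and
    -- these sets are directed because `r` is closed under intersections. A common point y satisfies
    -- yx = r.
    ·-closed : ∀ {T} x → Closed T → Closed (T · x)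
    ·-closed {T} x T-closed {r} r∈cl =
      let y , y∈K = compactness K (Gₛ , full r) K-closed K-nonempty K-directed in
      y , proj₁ (y∈K (Gₛ , full r)) , members-⊆⇒≈β r (y ⊙ x) λ A∈r → lower (proj₂ (y∈K (_ , A∈r)))
      where
      K : (∃[ A ] A ∈ members r) → SubsetOfβG
      K (A , _) y = y ∈ T × Lift (lsuc v) (A ∈ members (y ⊙ x))

      K-closed : ∀ i → Closed (K i)
      K-closed (A , A∈r) {y} y∈cl =
        T-closed (λ B B∈y → let z , (z∈T , _) , B∈z = y∈cl B B∈y in z , z∈T , B∈z) ,
        -- Right translation is continuous: otherwise the complement of `fibre x A` is a
        -- neighbourhood of `y` missing `K (A , A∈r)`.
        lift (fibre∈⇒∈⊙ y x A (by-contradiction λ f∉y →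
          let z , (_ , lift A∈zx) , ∁f∈z = y∈cl _ (∉⇒∁∈ y f∉y) in
          disjoint z (∈⊙⇒fibre∈ z x A A∈zx) ∁f∈z))

      K-nonempty : ∀ i → ∃ (K i)
      K-nonempty (A , A∈r) = let s , (y , y∈T , s≈yx) , A∈s = r∈cl A A∈r in
        y , y∈T , lift (to (s≈yx A) A∈s)

      K-directed : ∀ i j → ∃[ k ] (K k ⊆ K i × K k ⊆ K j)
      K-directed (A , A∈r) (B , B∈r) = (A ∩ₛ B , meet r A∈r B∈r) ,
        (λ {y} (y∈T , lift AB) → y∈T , lift (upward (y ⊙ x) {A ∩ₛ B} {A} (∩-elimˡ A B) AB)) ,
        (λ {y} (y∈T , lift AB) → y∈T , lift (upward (y ⊙ x) {A ∩ₛ B} {B} (∩-elimʳ A B) AB))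

    fixers-closed : ∀ {T} r → Closed T → Closed (λ y → y ∈ T × Lift (lsuc v) (y ⊙ r ≈β r))
    fixers-closed r T-closed {y} y∈cl =
      T-closed (λ B B∈y → let z , (z∈T , _) , B∈z = y∈cl B B∈y in z , z∈T , B∈z) ,
      lift (members-⊆⇒≈β (y ⊙ r) r λ {A} A∈yr →
        let z , (_ , lift zr≈r) , f∈z = y∈cl _ (∈⊙⇒fibre∈ y r A A∈yr) in
        to (zr≈r A) (fibre∈⇒∈⊙ z r A f∈z))

    fixers-⊙ : ∀ {p q r} → p ⊙ r ≈β r → q ⊙ r ≈β r → (p ⊙ q) ⊙ r ≈β r
    fixers-⊙ {p} {q} {r} pr≈r qr≈r =
      ≈β-trans {(p ⊙ q) ⊙ r} {p ⊙ (q ⊙ r)} {r} (⊙-assoc p q r)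
        (≈β-trans {p ⊙ (q ⊙ r)} {p ⊙ r} {r} (⊙-cong {p} {p} {q ⊙ r} {r} (≈β-refl {p}) qr≈r) pr≈r)

    IsSubsemigroup : Pred SubsetOfβG (lsuc v)
    IsSubsemigroup S = ∀ {p q} → p ∈ S → q ∈ S → p ⊙ q ∈ S

    -- Let `T` be a minimal closed subsemigroup and x ∈ T. Then Tx is a closed subsemigroup of `T`,
    -- so Tx = T and x = yx for some y in `T`. Hence { y ∈ T | yx = x } is a nonempty closed
    -- subsemigroup, again all of `T`, and contains x itself.
    ellis-numakura : ∀ S → Closed S → ∃ S → IsSubsemigroup S → ∃[ e ] (e ∈ S × e ∈ Idempotent)
    ellis-numakura S S-closed S-nonempty S-sub
      with T , T⊆S , T-closed , (x , x∈T) , T-sub , T-minimal ←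
             minimal-closed IsSubsemigroup
               (λ K K-sub p∈ q∈ → resize λ i → K-sub i (unresize p∈ i) (unresize q∈ i))
               S S-closed S-nonempty S-sub
      = x , T⊆S x∈T , lower (proj₂ (T⊆fixers x∈T))
      where
      Tx⊆T : T · x ⊆ T
      Tx⊆T {r} (y , y∈T , r≈yx) = closed-resp {p = y ⊙ x} {r} T-closed (≈β-sym {r} {y ⊙ x} r≈yx) (T-sub y∈T x∈T)

      Tx-sub : IsSubsemigroup (T · x)
      Tx-sub {p} {q} (y , y∈T , p≈yx) q∈Tx@(z , z∈T , q≈zx) =
        p ⊙ z , T-sub (Tx⊆T (y , y∈T , p≈yx)) z∈T ,
        ≈β-trans {p ⊙ q} {p ⊙ (z ⊙ x)} {(p ⊙ z) ⊙ x} (⊙-cong {p} {p} {q} {z ⊙ x} (≈β-refl {p}) q≈zx)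
          (≈β-sym {(p ⊙ z) ⊙ x} {p ⊙ (z ⊙ x)} (⊙-assoc p z x))

      x∈Tx : x ∈ T · x
      x∈Tx = T-minimal (T · x) (λ {r} → ·-closed {T} x T-closed {r}) (x ⊙ x , x , x∈T , ≈β-refl {x ⊙ x})
        (λ {p} {q} → Tx-sub {p} {q}) Tx⊆T x∈T

      fixers : SubsetOfβG
      fixers y = y ∈ T × Lift (lsuc v) (y ⊙ x ≈β x)

      T⊆fixers : T ⊆ fixers
      T⊆fixers = let y , y∈T , x≈yx = x∈Tx in
        T-minimal fixers (fixers-closed x T-closed) (y , y∈T , lift (≈β-sym {x} {y ⊙ x} x≈yx))
          (λ {p} {q} (p∈T , lift px≈x) (q∈T , lift qx≈x) → T-sub p∈T q∈T , lift (fixers-⊙ {p} {q} {x} px≈x qx≈x))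
          proj₁

    -- Free ultrafilters

    ∈∁｛｝⇒≉ : ∀ {x y} → y ∈ El ∁｛ x ｝ → ¬ (y ≈ x)
    ∈∁｛｝⇒≉ = toWitness

    ≉⇒∈∁｛｝ : ∀ {x y} → ¬ (y ≈ x) → y ∈ El ∁｛ x ｝
    ≉⇒∈∁｛｝ = fromWitness

    free⇒∁｛｝∈ : ∀ p → p ∈ Free → ∀ x → ∁｛ x ｝ ∈ members p
    free⇒∁｛｝∈ p p-free x = let A , A∈p , x∉A = p-free x in
      upward p (λ y∈A → ≉⇒∈∁｛｝ λ y≈x → x∉A (resp A y≈x y∈A)) A∈p

    ∁｛｝∈⇒free : ∀ p → (∀ x → ∁｛ x ｝ ∈ members p) → p ∈ Free
    ∁｛｝∈⇒free p ∁∈p x = ∁｛ x ｝ , ∁∈p x , λ x∈ → ∈∁｛｝⇒≉ x∈ ≈-refl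

    -- For each x, the equation xy = z excludes only the point x⁻¹z, which the free `q` avoids.
    ⊙-free : ∀ p q → q ∈ Free → p ⊙ q ∈ Free
    ⊙-free p q q-free = ∁｛｝∈⇒free (p ⊙ q) λ z → Gₛ , full p , (λ x → ∁｛ x \\ z ｝) ,
      (λ {x} _ → free⇒∁｛｝∈ q q-free (x \\ z)) ,
      λ {x} {y} _ y∈ → ≉⇒∈∁｛｝ λ xy≈z → ∈∁｛｝⇒≉ y∈ (y≈x\\z x y z xy≈z)

    -- Basic open sets are also closed.
    cl-member : ∀ {K : SubsetOfβG} {p A} → (∀ {q} → q ∈ K → A ∈ members q) → p ∈ cl K → A ∈ members p
    cl-member {p = p} A∈K p∈cl = by-contradiction λ A∉p →
      let q , q∈K , ∁A∈q = p∈cl _ (∉⇒∁∈ p A∉p) in disjoint q (A∈K q∈K) ∁A∈q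

    -- Extend the filter of sets containing all but finitely many points of `X`; it is proper
    -- because `X` is infinite.
    infinite⇒free : ∀ X → Infinite setoid (El X) → ∃ (X *)
    infinite⇒free X X-inf = p , ∁｛｝∈⇒free p (λ x → F⊆p (x ∷ [] , λ _ y∉ → ≉⇒∈∁｛｝ λ y≈x → y∉ (here y≈x))) ,
      F⊆p ([] , λ x∈X _ → x∈X)
      where
      F : Pred Subset v
      F A = ∃[ xs ] (∀ {x} → x ∈ El X → ¬ (x ∈ₗ xs) → x ∈ El A)
      F-filter : IsProperFilter F
      F-filter = record
        { full = [] , _
        ; proper = λ (xs , X∖xs⊆∅) → X-inf (xs , λ x∈X → by-contradiction λ x∉xs → X∖xs⊆∅ x∈X x∉xs)
        ; upward = λ A⊆B (xs , ⊆A) → xs , λ x∈X x∉xs → A⊆B (⊆A x∈X x∉xs)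
        ; meet = λ {A} {B} (xs , ⊆A) (ys , ⊆B) → xs ++ ys , λ x∈X x∉ →
            ∩-intro A B (⊆A x∈X (x∉ ∘ ListMembershipₚ.∈-++⁺ˡ setoid)) (⊆B x∈X (x∉ ∘ ListMembershipₚ.∈-++⁺ʳ setoid xs))
        }
      extension : ∃[ p ] F ⊆ members p
      extension = ultrafilter-lemma F-filter
      p : Ultrafilter
      p = proj₁ extension
      F⊆p : F ⊆ members p
      F⊆p = proj₂ extension

    -- The action of G on βG is free

    ∈◂⇒preimage∈ : ∀ g p A → A ∈ members (g ◂ p) → preimage g A ∈ members p
    ∈◂⇒preimage∈ g p A (P , P∈p , _ , ⊇) = upward p (λ {x} x∈P → ⊇ (x , x∈P , ≈-refl)) P∈p

    preimage∈⇒∈◂ : ∀ g p A → preimage g A ∈ members p → A ∈ members (g ◂ p)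
    preimage∈⇒∈◂ g p A m = preimage g A , m , translate≐ g A

    preimage-cong : ∀ p A {g h} → g ≈ h → preimage g A ∈ members p → preimage h A ∈ members p
    preimage-cong p A {g} {h} g≈h = upward p {preimage g A} {preimage h A} (resp A (∙-congʳ g≈h))

    ◂-congʳ : ∀ {g h} p → g ≈ h → g ◂ p ≈β h ◂ p
    ◂-congʳ {g} {h} p g≈h = members-⊆⇒≈β (g ◂ p) (h ◂ p) λ {A} A∈gp → preimage∈⇒∈◂ h p A
      (preimage-cong p A g≈h (∈◂⇒preimage∈ g p A A∈gp))

    -- Take `A` maximal among the sets disjoint from their translate by t. A point z outside `A`,
    -- t⁻¹A and tA could be added to `A`, because tz = z would force t = ε.
    disjoint-translate : ∀ t → ¬ (t ≈ ε) →
      ∃[ A ] ((∀ {x} → x ∈ El A → t ∙ x ∉ El A) ×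
              (∀ x → x ∈ El A ⊎ (t ∙ x ∈ El A ⊎ t \\ x ∈ El A)))
    disjoint-translate t t≉ε = A , A-disjoint , cover
      where
      Candidate : Set v
      Candidate = ∃[ A ] (∀ {x} → x ∈ El A → t ∙ x ∉ El A)

      maximal : ∃[ m ] (El ∅ₛ ⊆ El (proj₁ m) ×
        (∀ (B : Candidate) → El (proj₁ m) ⊆ El (proj₁ B) → El (proj₁ B) ⊆ El (proj₁ m)))
      maximal = maximal-above {A = Candidate} (λ A B → El (proj₁ A) ⊆ El (proj₁ B)) id (λ f g → g ∘ f)
        union-bounds (∅ₛ , λ ())
        where
        union-bounds : (C : Pred Candidate v) → ∃ C →
          (∀ {A B} → A ∈ C → B ∈ C → El (proj₁ A) ⊆ El (proj₁ B) ⊎ El (proj₁ B) ⊆ El (proj₁ A)) →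
          Σ[ B ∈ Candidate ] (∀ {A} → A ∈ C → El (proj₁ A) ⊆ El (proj₁ B))
        union-bounds C _ chain = (⋃C , ⋃C-disjoint) , λ A∈C x∈A → fromWitness (_ , A∈C , x∈A)
          where
          ⋃C : Subset
          ⋃C = subset (λ x → ∃[ A ] (A ∈ C × x ∈ El (proj₁ A)))
            (λ x≈y (A , A∈C , x∈A) → A , A∈C , resp (proj₁ A) x≈y x∈A)
          ⋃C-disjoint : ∀ {x} → x ∈ El ⋃C → t ∙ x ∉ El ⋃C
          ⋃C-disjoint x∈ tx∈ with toWitness x∈ | toWitness tx∈
          ... | (A , A-disj) , A∈C , x∈A | (B , B-disj) , B∈C , tx∈B with chain A∈C B∈C
          ... | inj₁ A⊆B = B-disj (A⊆B x∈A) tx∈B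
          ... | inj₂ B⊆A = A-disj x∈A (B⊆A tx∈B)

      A : Subset
      A = proj₁ (proj₁ maximal)
      A-disjoint : ∀ {x} → x ∈ El A → t ∙ x ∉ El A
      A-disjoint = proj₂ (proj₁ maximal)

      cover : ∀ x → x ∈ El A ⊎ (t ∙ x ∈ El A ⊎ t \\ x ∈ El A)
      cover z = by-contradiction λ ∉ → ∉ (inj₁ (proj₂ (proj₂ maximal) (A∪z , A∪z-disjoint
          (∉ ∘ inj₂ ∘ inj₁) (∉ ∘ inj₂ ∘ inj₂))
          (fromWitness ∘ inj₁) (fromWitness (inj₂ ≈-refl))))
        where
        A∪z : Subset
        A∪z = subset (λ x → x ∈ El A ⊎ x ≈ z) λ x≈y →
          [ inj₁ ∘ resp A x≈y , (λ x≈z → inj₂ (≈-trans (≈-sym x≈y) x≈z)) ]′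
        A∪z-disjoint : t ∙ z ∉ El A → t \\ z ∉ El A → ∀ {x} → x ∈ El A∪z → t ∙ x ∉ El A∪z
        A∪z-disjoint tz∉A t⁻¹z∉A {x} x∈ tx∈ with toWitness x∈ | toWitness tx∈
        ... | inj₁ x∈A | inj₁ tx∈A = A-disjoint x∈A tx∈A
        ... | inj₁ x∈A | inj₂ tx≈z = t⁻¹z∉A (resp A (y≈x\\z t x z tx≈z) x∈A)
        ... | inj₂ x≈z | inj₁ tx∈A = tz∉A (resp A (∙-congˡ x≈z) tx∈A)
        ... | inj₂ x≈z | inj₂ tx≈z = t≉ε (identityˡ-unique t x (≈-trans tx≈z (≈-sym x≈z)))

    -- If t ≠ ε, one of the covering sets `A`, t⁻¹A, tA is in `p`. Invariance then puts both `A` and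
    -- t⁻¹A in `p`, although they are disjoint.
    fixing-translation-trivial : ∀ p t → (∀ A → A ∈ members p ⇔ preimage t A ∈ members p) → t ≈ ε
    fixing-translation-trivial p t t-fixes = by-contradiction λ t≉ε →
      let A , tA-disj , cover = disjoint-translate t t≉ε
          not-in : A ∉ members p
          not-in A∈p = proper p (upward p
            (λ u → tA-disj (∩-elimˡ A (preimage t A) u) (∩-elimʳ A (preimage t A) u))
            (meet p A∈p (to (t-fixes A) A∈p)))
          back : preimage (t ⁻¹) A ∈ members p → A ∈ members p
          back m = upward p {preimage t (preimage (t ⁻¹) A)} {A} (λ {x} → resp A (\\-leftDividesʳ t x))
            (to (t-fixes (preimage (t ⁻¹) A)) m)
          A∪ : Subset
          A∪ = subset (λ x → t ∙ x ∈ El A ⊎ t \\ x ∈ El A)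
            (λ x≈y → [ inj₁ ∘ resp A (∙-congˡ x≈y) , inj₂ ∘ resp A (∙-congˡ x≈y) ]′)
      in case ∪∈⇒∈⊎∈ p A A∪ {Gₛ} (full p) (λ {x} _ → [ inj₁ , inj₂ ∘ fromWitness ]′ (cover x)) of λ where
        (inj₁ A∈p) → not-in A∈p
        (inj₂ A∪∈p) → case ∪∈⇒∈⊎∈ p (preimage t A) (preimage (t ⁻¹) A) {A∪} A∪∈p toWitness of λ where
          (inj₁ tA∈p) → not-in (from (t-fixes A) tA∈p)
          (inj₂ t⁻¹A∈p) → not-in (back t⁻¹A∈p)

    -- If gp = hp then translation by g⁻¹h fixes `p`, so g⁻¹h = ε.
    ◂-injective : ∀ p → Injective _≈_ _≈β_ (_◂ p)
    ◂-injective p {g} {h} gp≈hp = ≈-trans (≈-sym (identityʳ g)) (≈-trans (∙-congˡ (≈-sym t≈ε)) (\\-leftDividesˡ g h))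
      where
      t≈ε : g \\ h ≈ ε
      t≈ε = fixing-translation-trivial p (g \\ h) λ A →
        let gA = preimage (g ⁻¹) A in mk⇔
        (λ A∈p → upward p {preimage h gA} {preimage (g \\ h) A}
          (λ {x} → resp A (≈-sym (assoc (g ⁻¹) h x)))
          (∈◂⇒preimage∈ h p gA (to (gp≈hp gA) (preimage∈⇒∈◂ g p gA
            (upward p {A} {preimage g gA} (λ {x} → resp A (≈-sym (\\-leftDividesʳ g x))) A∈p)))))
        (λ m → upward p {preimage g gA} {A} (λ {x} → resp A (\\-leftDividesʳ g x))
          (∈◂⇒preimage∈ g p gA (from (gp≈hp gA) (preimage∈⇒∈◂ h p gA
            (upward p {preimage (g \\ h) A} {preimage h gA} (λ {x} → resp A (assoc (g ⁻¹) h x)) m)))))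

    -- Δ_r(X) is the image of `fibre r X` under g ↦ gr.
    infinite-Δ⇒infinite-fibre : ∀ r X → Infinite βG (Δ r X) → Infinite setoid (El (fibre r X))
    infinite-Δ⇒infinite-fibre r X Δ-inf (xs , f⊆xs) = Δ-inf (map (_◂ r) xs , λ {q} (g , X∈gr , q≈gr) →
      ListMembershipₚ.∈-resp-≈ βG {map (_◂ r) xs} {g ◂ r} {q} (≈β-sym {q} {g ◂ r} q≈gr)
        (ListMembershipₚ.∈-map⁺ setoid βG (◂-congʳ r) (f⊆xs (fibre-intro r X (∈◂⇒preimage∈ g r X X∈gr)))))

    -- Non-scattered sets

    _*β : Subset → SubsetOfβG
    (X *β) p = Lift (lsuc v) (p ∈ X *)

    *β-closed : ∀ X → Closed (X *β)
    *β-closed X {p} p∈cl = lift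
      ( ∁｛｝∈⇒free p (λ x → cl-member {X *β} {p} (λ {q} (lift (q-free , _)) → free⇒∁｛｝∈ q q-free x) p∈cl)
      , cl-member {X *β} {p} (λ (lift (_ , X∈q)) → X∈q) p∈cl )

    module _ (X : Subset) where

      IsInvariant : Pred SubsetOfβG (lsuc v)
      IsInvariant K = ∀ {p q} → p ∈ K → q ∈ Free → X ∈ members (q ⊙ p) → q ⊙ p ∈ K

      *β-invariant : IsInvariant (X *β)
      *β-invariant {p} {q} (lift (p-free , _)) _ X∈qp = lift (⊙-free q p p-free , X∈qp)

      -- A minimal closed invariant set M is { qr | q ∈ G*, X ∈ qr } for each
      -- r ∈ M, so r itself has the form qr.
      recurrent-point : Infinite setoid (El X) → (∀ p → p ∈ X * → Infinite βG (Δ p X)) →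
        ∃[ r ] (X ∈ members r × (∃[ q ] (q ∈ Free × q ⊙ r ≈β r)))
      recurrent-point X-inf Δ-inf
        with M , M⊆X* , M-closed , (r , r∈M) , M-inv , M-minimal ←
               minimal-closed IsInvariant
                 (λ K K-inv {p} {q} p∈ q-free X∈qp → resize λ i → K-inv i {p} {q} (unresize p∈ i) q-free X∈qp)
                 (X *β) (λ {p} → *β-closed X {p}) 
                 (let p , p∈X* = infinite⇒free X X-inf in p , lift p∈X*)
                 (λ {p} {q} → *β-invariant {p} {q})
        = let q , lift (q-free , _) , r≈qr = r∈Qr in
          r , proj₂ (lower (M⊆X* r∈M)) , q , q-free , ≈β-sym {r} {q ⊙ r} r≈qr
        where
        Q : SubsetOfβG
        Q = fibre r X *β

        r∈Qr : r ∈ Q · r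
        r∈Qr = M-minimal (Q · r) (λ {p} → ·-closed {Q} r (λ {q} → *β-closed (fibre r X) {q}) {p})
          -- Infinitude of Δ_r(X) enters here: it yields a free `q` containing `fibre r X`, so that
          -- the candidate is nonempty.
          (let q , q∈ = infinite⇒free (fibre r X) (infinite-Δ⇒infinite-fibre r X (Δ-inf r (lower (M⊆X* r∈M))))
           in q ⊙ r , q , lift q∈ , ≈β-refl {q ⊙ r})
          (λ {p} {y} (q , lift (q-free , _) , p≈qr) y-free X∈yp →
            let yp≈yqr : y ⊙ p ≈β (y ⊙ q) ⊙ r
                yp≈yqr = ≈β-trans {y ⊙ p} {y ⊙ (q ⊙ r)} {(y ⊙ q) ⊙ r}
                           (⊙-cong {y} {y} {p} {q ⊙ r} (≈β-refl {y}) p≈qr)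
                           (≈β-sym {(y ⊙ q) ⊙ r} {y ⊙ (q ⊙ r)} (⊙-assoc y q r))
            in y ⊙ q , lift (⊙-free y q q-free , ∈⊙⇒fibre∈ (y ⊙ q) r X (to (yp≈yqr X) X∈yp)) , yp≈yqr)
          -- The candidate lies inside `M` because `M` is invariant.
          (λ {p} (q , lift (q-free , X∈) , p≈qr) → closed-resp {M} {q ⊙ r} {p} M-closed
             (≈β-sym {p} {q ⊙ r} p≈qr) (M-inv {r} {q} r∈M q-free (fibre∈⇒∈⊙ q r X X∈)))
          r∈M

    -- The free y with yr = r form a closed subsemigroup containing `q`.
    free-idempotent-fixing : ∀ {q} r → q ∈ Free → q ⊙ r ≈β r →
      ∃[ e ] (e ∈ Free × e ∈ Idempotent × e ⊙ r ≈β r)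
    free-idempotent-fixing {q} r q-free qr≈r =
      let e , (lift (e-free , _) , lift er≈r) , e-idem =
            ellis-numakura S (λ {p} → S-closed {p}) (q , lift (q-free , full q) , lift qr≈r) (λ {p} {q} → S-sub {p} {q})
      in e , e-free , e-idem , er≈r
      where
      S : SubsetOfβG
      S y = y ∈ Gₛ *β × Lift (lsuc v) (y ⊙ r ≈β r)
      S-closed : Closed S
      S-closed {p} = fixers-closed {Gₛ *β} r (λ {p} → *β-closed Gₛ {p}) {p}
      S-sub : IsSubsemigroup S
      S-sub {p} {q} (_ , lift pr≈r) (lift (q-free , _) , lift qr≈r) =
        lift (⊙-free p q q-free , full (p ⊙ q)) , lift (fixers-⊙ {p} {q} {r} pr≈r qr≈r)

    free-idempotent : Infinite setoid U → ∃[ e ] (e ∈ Free × e ∈ Idempotent)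
    free-idempotent G-inf =
      let p , p∈G* = infinite⇒free Gₛ (λ (xs , ⊆xs) → G-inf (xs , λ _ → ⊆xs _))
          e , lift (e-free , _) , e-idem = ellis-numakura (Gₛ *β) (λ {p} → *β-closed Gₛ {p}) (p , lift p∈G*)
            (λ {p} {q} _ (lift (q-free , _)) → lift (⊙-free p q q-free , full (p ⊙ q)))
      in e , e-free , e-idem

    ¬scattered⇒∈idempotent-multiple : ∀ A → A ∉ Scattered → ∃[ r ] (r ∈ FreeIdempotentMultiples × A ∈ members r)
    ¬scattered⇒∈idempotent-multiple A A-not-scattered =
      let X , ¬scattered = ¬∀⇒∃¬ A-not-scattered
          X⊆A : El X ⊆ El A
          -- If any premise in the definition of scatteredness failed for `X`, its instance at `X`
          -- would hold vacuously.
          X⊆A = by-contradiction λ X⊈A → ¬scattered λ X⊆A → contradiction (λ {x} → X⊆A {x}) X⊈A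
          X-inf : Infinite setoid (El X)
          X-inf X-fin = ¬scattered λ _ X-inf → contradiction X-fin X-inf
          Δ-inf : ∀ p → p ∈ X * → Infinite βG (Δ p X)
          Δ-inf p p∈X* Δ-fin = ¬scattered λ _ _ → p , p∈X* , Δ-fin
          r , X∈r , q , q-free , qr≈r = recurrent-point X X-inf Δ-inf
          e , e-free , e-idem , er≈r = free-idempotent-fixing {q} r q-free qr≈r
      in r , (e , r , e-free , e-idem , ≈β-sym {e ⊙ r} {r} er≈r) , upward r X⊆A X∈r

    -- Piecewise shifted FP-sets

    module FPSequences {e r} (e-free : e ∈ Free) (er≈r : e ⊙ r ≈β r) {A₀} (A₀∈r : A₀ ∈ members r) where

      -- The first set must contain all products still to be formed; the second contains the group
      -- elements still allowed as factors.
      State : Set v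
      State = ∃ (members r) × ∃ (members e)

      pick : ((( A , _) , (C , _)) : State) → ∃[ g ] (g ∈ El C × preimage g A ∈ members r)
      pick ((A , A∈r) , (C , C∈e)) =
        -- From A ∈ r = er, the set { g | g⁻¹A ∈ r } is in `e`, and so it meets `C`.
        let g , t = nonempty e (meet e C∈e (∈⊙⇒fibre∈ e r A (from (er≈r A) A∈r)))
        in g , ∩-elimˡ C (fibre r A) t , fibre-elim r A (∩-elimʳ C (fibre r A) t)

      next : State → State
      next s@((A , A∈r) , (C , C∈e)) = let g , _ , g⁻¹A∈r = pick s in
        (A ∩ₛ preimage g A , meet r A∈r g⁻¹A∈r) , (C ∩ₛ ∁｛ g ｝ , meet e C∈e (free⇒∁｛｝∈ e e-free g))

      state : ℕ → State
      state zero = (A₀ , A₀∈r) , (Gₛ , full e)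
      state (suc n) = next (state n)

      A C : ℕ → Subset
      A n = proj₁ (proj₁ (state n))
      C n = proj₁ (proj₂ (state n))

      g b : ℕ → Carrier
      g n = proj₁ (pick (state n))
      b n = proj₁ (nonempty r (proj₂ (proj₂ (pick (state n)))))

      decreasing : ∀ (B : ℕ → Subset) → (∀ n → El (B (suc n)) ⊆ El (B n)) → ∀ {m n} → m ≤′ n → El (B n) ⊆ El (B m)
      decreasing B B-dec ≤′-refl = id
      decreasing B B-dec (≤′-step m≤n) = λ x∈B → decreasing B B-dec m≤n (B-dec _ x∈B)

      A-decreasing : ∀ {m n} → m ≤ n → El (A n) ⊆ El (A m)
      A-decreasing m≤n = decreasing A (λ n → ∩-elimˡ (A n) (preimage (g n) (A n))) (≤⇒≤′ m≤n)

      C-decreasing : ∀ {m n} → m ≤ n → El (C n) ⊆ El (C m)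
      C-decreasing m≤n = decreasing C (λ n → ∩-elimˡ (C n) ∁｛ g n ｝) (≤⇒≤′ m≤n)

      -- Induction from the right: the rest of the product lies in `A j`, hence in `A (suc i)`,
      -- which is contained in the preimage of `A i` under left multiplication by `g i`. The element
      -- `b i` was chosen to start the induction.
      product∈A : ∀ i is → Linked _<_ (i ∷ is) → shiftedProduct g b i is ∈ El (A i)
      product∈A i [] [-] = proj₂ (nonempty r (proj₂ (proj₂ (pick (state i)))))
      product∈A i (j ∷ js) (i<j ∷ linked) =
        ∩-elimʳ (A i) (preimage (g i) (A i)) (A-decreasing i<j (product∈A j js linked))

      g-distinct : ∀ {m n} → m < n → ¬ (g n ≈ g m)
      g-distinct {m} {n} m<n = ∈∁｛｝⇒≉ (∩-elimʳ (C m) ∁｛ g m ｝ (C-decreasing m<n (proj₁ (proj₂ (pick (state n))))))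

      g-injective : Injective _≡_ _≈_ g
      g-injective {m} {n} gm≈gn with <-cmp m n
      ... | tri< m<n _ _ = contradiction (≈-sym gm≈gn) (g-distinct m<n)
      ... | tri≈ _ m≡n _ = m≡n
      ... | tri> _ _ n<m = contradiction gm≈gn (g-distinct n<m)

    fixed⇒contains-FP : ∀ {e r A} → e ∈ Free → e ⊙ r ≈β r → A ∈ members r → ContainsPiecewiseShiftedFP A
    fixed⇒contains-FP {e} {r} {A} e-free er≈r A∈r =
      g , b , g-injective , λ (i , is , linked , x≈) →
        resp A (≈-sym x≈) (A-decreasing {0} {i} ℕ.z≤n (product∈A i is linked))
      where open FPSequences {e} {r} e-free er≈r {A} A∈r hiding (A)

    idempotent-multiple⇒contains-FP : ∀ {r A} → r ∈ FreeIdempotentMultiples → A ∈ members r → ContainsPiecewiseShiftedFP A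
    idempotent-multiple⇒contains-FP {r} {A} (e , p , e-free , e-idem , r≈ep) A∈r =
      fixed⇒contains-FP {e} {e ⊙ p} {A} e-free
        -- Idempotence gives e(ep) = (ee)p = ep.
        (≈β-trans {e ⊙ (e ⊙ p)} {(e ⊙ e) ⊙ p} {e ⊙ p} (≈β-sym {(e ⊙ e) ⊙ p} {e ⊙ (e ⊙ p)} (⊙-assoc e e p))
          (⊙-cong {e ⊙ e} {e} {p} {p} e-idem (≈β-refl {p})))
        (to (r≈ep A) A∈r)

    -- Tails of FP-sets and their quotients.

    -- A finite set has only finitely many quotients. A set is thus infinite as soon as every `g n`
    -- is a quotient of two of its elements.
    quotients-escape : ∀ {g : ℕ → Carrier} → Injective _≡_ _≈_ g → ∀ xs →
      ¬ (∀ n → ∃[ x ] ∃[ y ] (x ∈ₗ xs × y ∈ₗ xs × g n ≈ x // y))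
    quotients-escape g-inj xs cover = injective-sequence-escapes setoid g-inj (cartesianProductWith _//_ xs xs)
      λ n → let x , y , x∈xs , y∈xs , gn≈x/y = cover n in
        ListMembershipₚ.∈-resp-≈ setoid (≈-sym gn≈x/y)
          (ListMembershipₚ.∈-cartesianProductWith⁺ setoid setoid setoid //-cong₂ x∈xs y∈xs)

    module FPTails (g b : ℕ → Carrier) where

      Tail : ℕ → Pred Carrier ℓ
      Tail m x = ∃[ i ] ∃[ is ] (m ≤ i × Linked _<_ (i ∷ is) × x ≈ shiftedProduct g b i is)

      -- The leading index exceeds `m`, or is `m` and the only one, or is `m` and is followed by
      -- larger ones.
      tail-cases : ∀ m {x} → x ∈ Tail m → x ≈ g m ∙ b m ⊎ (x ∈ Tail (suc m) ⊎ g m \\ x ∈ Tail (suc m))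
      tail-cases m {x} (i , is , m≤i , linked , x≈) with m≤n⇒m<n∨m≡n m≤i
      ... | inj₁ m<i = inj₂ (inj₁ (i , is , m<i , linked , x≈))
      ... | inj₂ refl with is | linked
      ... | [] | [-] = inj₁ x≈
      ... | j ∷ js | m<j ∷ linked′ =
        inj₂ (inj₂ (j , js , m<j , linked′ , ≈-trans (∙-congˡ x≈) (\\-leftDividesʳ (g m) _)))

      last∈tail : ∀ m → g m ∙ b m ∈ Tail m
      last∈tail m = m , [] , ≤-refl , [-] , ≈-refl

      tail-prepend : ∀ m {x} → x ∈ Tail (suc m) → g m ∙ x ∈ Tail m
      tail-prepend m (i , is , m<i , linked , x≈) = m , i ∷ is , ≤-refl , m<i ∷ linked , ∙-congˡ x≈

      Y : ℕ → Subset
      Y m = subset (Tail m) λ x≈y (i , is , m≤i , linked , x≈) → i , is , m≤i , linked , ≈-trans (≈-sym x≈y) x≈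

      Y⊆Y₀ : ∀ m → El (Y m) ⊆ El (Y 0)
      Y⊆Y₀ m t = let i , is , _ , linked , x≈ = toWitness t in fromWitness (i , is , ℕ.z≤n , linked , x≈)

      module _ (g-inj : Injective _≡_ _≈_ g) where

        -- Both `g (suc m) ∙ b (suc m)` and its left multiple by `g m` lie in `Y 0`, with quotient
        -- `g m`.
        Y₀-infinite : Infinite setoid (El (Y 0))
        Y₀-infinite (xs , ⊆xs) = quotients-escape g-inj xs λ m →
          let x = g (suc m) ∙ b (suc m) in
          g m ∙ x , x ,
          ⊆xs (Y⊆Y₀ m (fromWitness (tail-prepend m (last∈tail (suc m))))) ,
          ⊆xs (Y⊆Y₀ (suc m) (fromWitness (last∈tail (suc m)))) ,
          x≈z//y (g m) x (g m ∙ x) ≈-refl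

        module _ {p} (p-free : p ∈ Free) where

          D : Pred Carrier v
          D h = preimage h (Y 0) ∈ members p

          Y∈⇒D : ∀ m h → preimage h (Y m) ∈ members p → h ∈ D
          Y∈⇒D m h = upward p {preimage h (Y m)} {preimage h (Y 0)} (Y⊆Y₀ m)

          -- If h⁻¹ Y m ∈ p then h or g m \\ h moves Y (suc m) into p, and in
          -- both cases g m is a quotient of two elements of D.
          descend : ∀ m h → preimage h (Y m) ∈ members p →
            (∃[ k ] preimage k (Y (suc m)) ∈ members p) ×
            (∃[ x ] ∃[ y ] (x ∈ D × y ∈ D × g m ≈ x // y))
          descend m h Ym∈hp =
            -- As `p` is free, the only x with hx = `g m ∙ b m` may be removed; primality then
            -- selects one of the two remaining cases.
            case ∪∈⇒∈⊎∈ p (preimage h (Y (suc m))) (preimage (g m \\ h) (Y (suc m)))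
                   (meet p Ym∈hp (free⇒∁｛｝∈ p p-free last)) split of λ where
              (inj₁ stay) →
                (h , stay) , g m ∙ h , h ,
                Y∈⇒D m (g m ∙ h) (upward p {preimage h (Y (suc m))} {preimage (g m ∙ h) (Y m)}
                  (λ {x} t → resp (Y m) (≈-sym (assoc (g m) h x)) (fromWitness (tail-prepend m (toWitness t)))) stay) ,
                Y∈⇒D m h Ym∈hp ,
                x≈z//y (g m) h (g m ∙ h) ≈-refl
              (inj₂ move) →
                (g m \\ h , move) , h , g m \\ h ,
                Y∈⇒D m h Ym∈hp ,
                Y∈⇒D (suc m) (g m \\ h) move ,
                x≈z//y (g m) (g m \\ h) h (\\-leftDividesˡ (g m) h)
            where
            last : Carrier
            last = h \\ (g m ∙ b m)
            split : ∀ {x} → x ∈ El (preimage h (Y m) ∩ₛ ∁｛ last ｝) →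
              x ∈ El (preimage h (Y (suc m))) ⊎ x ∈ El (preimage (g m \\ h) (Y (suc m)))
            split {x} t with tail-cases m (toWitness (∩-elimˡ (preimage h (Y m)) ∁｛ last ｝ t))
            ... | inj₁ hx≈ = contradiction (y≈x\\z h x _ hx≈) (∈∁｛｝⇒≉ (∩-elimʳ (preimage h (Y m)) ∁｛ last ｝ t))
            ... | inj₂ (inj₁ stay) = inj₁ (fromWitness stay)
            ... | inj₂ (inj₂ move) = inj₂ (resp (Y (suc m)) (≈-sym (assoc (g m ⁻¹) h x)) (fromWitness move))

          D-infinite : Y 0 ∈ members p → Infinite setoid D
          D-infinite Y₀∈p (xs , ⊆xs) = quotients-escape g-inj xs λ m →
            let h , Ym∈hp = reach m ; x , y , x∈D , y∈D , gm≈x/y = proj₂ (descend m h Ym∈hp) in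
            x , y , ⊆xs x∈D , ⊆xs y∈D , gm≈x/y
            where
            reach : ∀ m → ∃[ h ] preimage h (Y m) ∈ members p
            -- The descent starts at ε, because `Y 0` itself is in `p`.
            reach zero = ε , upward p {Y 0} {preimage ε (Y 0)} (λ {x} → resp (Y 0) (≈-sym (identityˡ x))) Y₀∈p
            reach (suc m) = let h , Ym∈hp = reach m in proj₁ (descend m h Ym∈hp)

    contains-FP⇒¬scattered : ∀ A → ContainsPiecewiseShiftedFP A → A ∉ Scattered
    contains-FP⇒¬scattered A (g , b , g-inj , FP⊆A) A-scattered =
      let p , (p-free , Y₀∈p) , Δ-fin = A-scattered (Y 0)
            (λ t → let i , is , _ , linked , x≈ = toWitness t in FP⊆A (i , is , linked , x≈))
            (Y₀-infinite g-inj)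
          xs , ⊆xs = finite-preimage setoid βG {f = _◂ p} {Y = Δ p (Y 0)} (λ {g} {h} → ◂-injective p {g} {h}) Δ-fin
      in D-infinite g-inj {p} p-free Y₀∈p (xs , λ {h} h∈D →
           ⊆xs (h , preimage∈⇒∈◂ h p (Y 0) h∈D , ≈β-refl {h ◂ p}))
      where open FPTails g b

    -- Conjugating each `g n` by x and multiplying each `b n` by x on the left makes the inner x⁻¹x
    -- cancel, leaving x times the original product.
    translated-FP : ∀ x A → ContainsPiecewiseShiftedFP (preimage x A) → ContainsPiecewiseShiftedFP A
    translated-FP x A (g , b , g-inj , FP⊆) =
      g′ , b′ , (λ eq → g-inj (∙-cancelˡ x _ _ (∙-cancelʳ (x ⁻¹) _ _ eq))) ,
      λ (i , is , linked , y≈) → resp A (≈-sym (≈-trans y≈ (conjugated i is))) (FP⊆ (i , is , linked , ≈-refl))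
      where
      g′ b′ : ℕ → Carrier
      g′ n = x ∙ g n ∙ x ⁻¹
      b′ n = x ∙ b n
      step : ∀ h y → (x ∙ h ∙ x ⁻¹) ∙ (x ∙ y) ≈ x ∙ (h ∙ y)
      step h y = ≈-trans (assoc (x ∙ h) (x ⁻¹) (x ∙ y))
        (≈-trans (∙-congˡ (\\-leftDividesʳ x y)) (assoc x h y))
      conjugated : ∀ i is → shiftedProduct g′ b′ i is ≈ x ∙ shiftedProduct g b i is
      conjugated i [] = step (g i) (b i)
      conjugated i (j ∷ js) = ≈-trans (∙-congˡ (conjugated j js)) (step (g i) _)

    -- The ideal Sc^

    ∈Sc^⇔ : ∀ p → p ∈ Sc^ ⇔ (∀ A → A ∈ members p → ContainsPiecewiseShiftedFP A)
    ∈Sc^⇔ p = mk⇔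
      (λ p∈Sc^ A A∈p →
        let r , r∈ , A∈r = ¬scattered⇒∈idempotent-multiple A λ A-scattered → disjoint p {A} A∈p (p∈Sc^ A A-scattered)
        in idempotent-multiple⇒contains-FP {r} r∈ A∈r)
      (λ FP A A-scattered → ∉⇒∁∈ p λ A∈p → contains-FP⇒¬scattered A (FP A A∈p) A-scattered)

    Sc^⊆cl : Sc^ ⊆ cl FreeIdempotentMultiples
    Sc^⊆cl {p} p∈Sc^ A A∈p =
      ¬scattered⇒∈idempotent-multiple A λ A-scattered → disjoint p {A} A∈p (p∈Sc^ A A-scattered)

    cl⊆Sc^ : cl FreeIdempotentMultiples ⊆ Sc^
    cl⊆Sc^ {p} p∈cl = from (∈Sc^⇔ p) λ A A∈p →
      let r , r∈ , A∈r = p∈cl A A∈p in idempotent-multiple⇒contains-FP {r} r∈ A∈r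

    Sc^-closed : Closed Sc^
    Sc^-closed {p} p∈cl A A-scattered = cl-member {Sc^} {p} (λ q∈Sc^ → q∈Sc^ A A-scattered) p∈cl

    Sc^-contains-idempotents : ContainsFreeIdempotents Sc^
    Sc^-contains-idempotents e e-free e-idem = cl⊆Sc^ {e} λ A A∈e →
      e , (e , e , e-free , e-idem , ≈β-sym {e ⊙ e} {e} e-idem) , A∈e

    Sc^-ideal : Infinite setoid U → IsIdeal Sc^
    Sc^-ideal G-inf =
      (let e , e-free , e-idem = free-idempotent G-inf in e , Sc^-contains-idempotents e e-free e-idem) ,
      λ p q p∈Sc^ →
        -- A multiple es of a free idempotent containing `fibre q A` gives A ∈ (es)q = e(sq).
        cl⊆Sc^ {p ⊙ q} (λ A A∈pq →
          let r , (e , s , e-free , e-idem , r≈es) , f∈r = Sc^⊆cl {p} p∈Sc^ (fibre q A) (∈⊙⇒fibre∈ p q A A∈pq) in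
          e ⊙ (s ⊙ q) , (e , s ⊙ q , e-free , e-idem , ≈β-refl {e ⊙ (s ⊙ q)}) ,
          to (⊙-assoc e s q A) (fibre∈⇒∈⊙ (e ⊙ s) q A (to (r≈es (fibre q A)) f∈r))) ,
        -- Here A ∈ qp gives some x with x⁻¹A ∈ p; translating the FP-set inside it by x lands in
        -- `A`.
        from (∈Sc^⇔ (q ⊙ p)) (λ A A∈qp →
          let x , x∈f = nonempty q (∈⊙⇒fibre∈ q p A A∈qp) in
          translated-FP x A (to (∈Sc^⇔ p) p∈Sc^ (preimage x A) (fibre-elim p A x∈f)))

    -- An ideal containing e contains every es, and these products are dense in `Sc^`.
    Sc^-least : ∀ J → Closed J → IsIdeal J → ContainsFreeIdempotents J → Sc^ ⊆ J
    Sc^-least J J-closed (_ , J-ideal) J-idem {p} p∈Sc^ = J-closed {p} λ A A∈p →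
      let r , (e , s , e-free , e-idem , r≈es) , A∈r = Sc^⊆cl {p} p∈Sc^ A A∈p in
      e ⊙ s , proj₁ (J-ideal e s (J-idem e e-free e-idem)) , to (r≈es A) A∈r

theorem6p8 : (∀ {a} → ExcludedMiddle a) →
    (∀ {a b d} → ZornsLemma a b d) →
    ∀ {c ℓ} (G : Group c ℓ) → let open Ultrafilters G in
    Infinite (Group.setoid G) U →
    (Sc^ ≐ cl FreeIdempotentMultiples) ×
    (IsIdeal Sc^ ×
    (∀ p → p ∈ Sc^ ⇔ (∀ A → A ∈ members p → ContainsPiecewiseShiftedFP A))) ×
    (Closed Sc^ × IsIdeal Sc^ × ContainsFreeIdempotents Sc^ ×
    (∀ J → Closed J → IsIdeal J → ContainsFreeIdempotents J → Sc^ ⊆ J))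
theorem6p8 em zorn G G-inf =
  ((λ {p} → Sc^⊆cl {p}) , (λ {p} → cl⊆Sc^ {p})) ,
  (Sc^-ideal G-inf , ∈Sc^⇔) ,
  ((λ {p} → Sc^-closed {p}) , Sc^-ideal G-inf , Sc^-contains-idempotents ,
    λ J J-closed J-ideal J-idem {p} → Sc^-least J (λ {q} → J-closed {q}) J-ideal J-idem {p})
  where open Classical.UltrafilterTheory em zorn G
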